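{- Let $1\le \ell\le m$ be integers and let $k=\binom{m}{\ell}$. Given $\Lambda\subseteq I_\ell[m]$, let $\Lambda^{\ast}:=\{[m]\setminus A : A\in\Lambda\}\subseteq I_{m-\ell}[m]$. Then $\Lambda$ is a subclose family in $I_\ell[m]$ if and only if $\Lambda^{\ast}$ is a subclose family in $I_{m-\ell}[m]$. Moreover, $$K_r(\ell,m)=\binom{r}{2}(2\ell-m)+K_r(m-\ell,m)\quad\text{for } 0\le r\le k.$$
   Context: $[m]:=\{1,\dots,m\}$. For an integer $0\le j\le m$, $I_j[m]$ denotes the set of all subsets of $[m]$ of cardinality $j$. For $\Lambda=\{A_1,\dots,A_r\}\subseteq I_j[m]$ with $|\Lambda|=r$ (the $A_i$ distinct), put $K_\Lambda:=\sum_{1\le i<i'\le r}|A_i\cap A_{i'}|$. For an integer $0\le r\le\binom{m}{j}$, put $K_r(j,m):=\max\{K_\Lambda : \Lambda\subseteq I_j[m],\ |\Lambda|=r\}$. A family $\Lambda\subseteq I_j[m]$ is called subclose (in $I_j[m]$) if $K_\Lambda=K_r(j,m)$, where $r=|\Lambda|$. -}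

module Defs where

open import Data.Bool.Base using (true; false)
open import Data.Bool.Properties using (not-injective) renaming (_≟_ to _≟ᵇ_)
open import Data.Empty using (⊥)
open import Data.Fin.Subset using (Subset; inside; outside; ∣_∣; _∩_; ∁)
open import Data.Fin.Subset.Properties using (∣∁p∣≡n∸∣p∣; ∩-comm)
open import Data.List.Base
  using (List; []; _∷_; [_]; map; filter; length; take; cartesianProductWith; _++_)
open import Data.List.Extrema.Nat using (max; xs≤max; argmax-sel)
open import Data.List.Membership.Propositional using (_∈_)
open import Data.List.Membership.Propositional.Properties
  using (∈-map⁺; ∈-map⁻; ∈-filter⁺; ∈-filter⁻; ∈-++⁺ˡ; ∈-++⁺ʳ;
         ∈-cartesianProductWith⁺; ∈-cartesianProductWith⁻)
open import Data.List.Properties using (length-map; length-take; length-++; filter-++)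
open import Data.List.Relation.Binary.Permutation.Propositional as Perm using (_↭_)
import Data.List.Relation.Binary.Permutation.Propositional.Properties as Perm
open import Data.List.Relation.Unary.All as All using (All; []; _∷_)
import Data.List.Relation.Unary.All.Properties as All
open import Data.List.Relation.Unary.Any using (here)
open import Data.List.Relation.Unary.Unique.Propositional using (Unique; []; _∷_)
import Data.List.Relation.Unary.Unique.Propositional.Properties as Unique
import Data.List.Relation.Unary.Unique.DecPropositional as UniqueDec
open import Data.Nat.Base using (ℕ; zero; suc; _+_; _∸_; _≤_; _≡ᵇ_)
open import Data.Nat.Combinatorics using (_C_; nCk+nC[k+1]≡[n+1]C[k+1])
open import Data.Nat.ListAction using (sum)
open import Data.Nat.ListAction.Properties using (sum-↭)
open import Data.Nat.Properties
  using (_≟_; m≤n⇒m⊓n≡m; +-comm; +-assoc; n≤0⇒n≡0)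
open import Data.Product.Base using (_×_; _,_; proj₁; proj₂; ∃-syntax; Σ-syntax)
open import Data.Sum.Base using (inj₁; inj₂)
open import Data.Vec.Base using (Vec; []; _∷_)
open import Data.Vec.Properties using (∷-injective; ∷-injectiveʳ; ≡-dec)
open import Function.Base using (id)
open import Relation.Binary.Definitions using (DecidableEquality)
open import Relation.Binary.PropositionalEquality
  using (_≡_; refl; sym; trans; cong; cong₂; subst; module ≡-Reasoning)

private
  variable
    m n j ℓ : ℕ
    A : Set

-- A finite set of subsets of [m] is given by a duplicate-free list of its
-- elements, in any order; `K-↭` shows that the order is irrelevant to K.
record Family (j m : ℕ) : Set where
  constructor family
  field
    members  : List (Subset m)
    distinct : Unique members
    sizes    : All (λ A → ∣ A ∣ ≡ j) members

open Family public

size : Family j m → ℕ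
size Λ = length (members Λ)

overlaps : List (Subset m) → ℕ
overlaps []       = 0
overlaps (A ∷ As) = sum (map (λ B → ∣ A ∩ B ∣) As) + overlaps As

K : Family j m → ℕ
K Λ = overlaps (members Λ)

subsets : ∀ m → List (Subset m)
subsets zero    = [ [] ]
subsets (suc m) = map (inside ∷_) (subsets m) ++ map (outside ∷_) (subsets m)

I : ∀ j m → List (Subset m)
I j m = filter (λ A → ∣ A ∣ ≟ j) (subsets m)

tuples : ℕ → List A → List (List A)
tuples zero    xs = [ [] ]
tuples (suc r) xs = cartesianProductWith _∷_ xs (tuples r xs)

_≟ˢ_ : DecidableEquality (Subset m)
_≟ˢ_ = ≡-dec _≟ᵇ_

-- All enumerations of r-element families, so each family occurs r! times.
enumerations : ∀ r j m → List (List (Subset m))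
enumerations r j m = filter (UniqueDec.unique? _≟ˢ_) (tuples r (I j m))

-- K_r(j,m).  The default value 0 of `max` is only relevant for r > m C j, when
-- there are no families; see `K≤Kmax` and `Kmax-attained`.
Kmax : ∀ r j m → ℕ
Kmax r j m = max 0 (map overlaps (enumerations r j m))

Subclose : Family j m → Set
Subclose {j} {m} Λ = K Λ ≡ Kmax (size Λ) j m

∁-injective : ∀ {A B : Subset m} → ∁ A ≡ ∁ B → A ≡ B
∁-injective {A = []}    {[]}    _  = refl
∁-injective {A = _ ∷ _} {_ ∷ _} eq with ∷-injective eq
... | eq₁ , eq₂ = cong₂ _∷_ (not-injective eq₁) (∁-injective eq₂)

infix 10 _⋆

_⋆ : Family ℓ m → Family (m ∸ ℓ) m
_⋆ {m = m} (family As u s) = record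
  { members  = map ∁ As
  ; distinct = Unique.map⁺ ∁-injective u
  ; sizes    = All.map⁺ (All.map (λ {A} ∣A∣≡ℓ → trans (∣∁p∣≡n∸∣p∣ A) (cong (m ∸_) ∣A∣≡ℓ)) s)
  }

overlaps-↭ : {As Bs : List (Subset m)} → As ↭ Bs → overlaps As ≡ overlaps Bs
overlaps-↭ Perm.refl         = refl
overlaps-↭ (Perm.prep A p)   = cong₂ _+_ (sum-↭ (Perm.map⁺ _ p)) (overlaps-↭ p)
overlaps-↭ (Perm.trans p q)  = trans (overlaps-↭ p) (overlaps-↭ q)
overlaps-↭ (Perm.swap {As} {Bs} A B p) = begin
  a + sum (f As) + (sum (g As) + overlaps As)       ≡⟨ +-assoc a (sum (f As)) _ ⟩
  a + (sum (f As) + (sum (g As) + overlaps As))     ≡⟨ cong (a +_) (+-assoc (sum (f As)) _ _) ⟨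
  a + (sum (f As) + sum (g As) + overlaps As)
    ≡⟨ cong₂ (λ x y → x + (y + overlaps As)) (cong ∣_∣ (∩-comm A B)) (+-comm (sum (f As)) _) ⟩
  b + (sum (g As) + sum (f As) + overlaps As)       ≡⟨ cong (b +_) (+-assoc (sum (g As)) _ _) ⟩
  b + (sum (g As) + (sum (f As) + overlaps As))     ≡⟨ +-assoc b (sum (g As)) _ ⟨
  b + sum (g As) + (sum (f As) + overlaps As)
    ≡⟨ cong₂ _+_ (cong (b +_) (sum-↭ (Perm.map⁺ _ p)))
                 (cong₂ _+_ (sum-↭ (Perm.map⁺ _ p)) (overlaps-↭ p)) ⟩
  b + sum (g Bs) + (sum (f Bs) + overlaps Bs)       ∎
  where
  open ≡-Reasoning
  a = ∣ A ∩ B ∣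
  b = ∣ B ∩ A ∣
  f = map (λ X → ∣ A ∩ X ∣)
  g = map (λ X → ∣ B ∩ X ∣)

K-↭ : (Λ Λ′ : Family j m) → members Λ ↭ members Λ′ → K Λ ≡ K Λ′
K-↭ _ _ = overlaps-↭

∈-subsets : (A : Subset m) → A ∈ subsets m
∈-subsets []            = here refl
∈-subsets (inside ∷ A)  = ∈-++⁺ˡ (∈-map⁺ _ (∈-subsets A))
∈-subsets (outside ∷ A) = ∈-++⁺ʳ _ (∈-map⁺ _ (∈-subsets A))

∈-I⁺ : {A : Subset m} → ∣ A ∣ ≡ j → A ∈ I j m
∈-I⁺ {A = A} = ∈-filter⁺ (λ A → ∣ A ∣ ≟ _) (∈-subsets A)

∈-I⁻ : {A : Subset m} → A ∈ I j m → ∣ A ∣ ≡ j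
∈-I⁻ {m} A∈I = proj₂ (∈-filter⁻ (λ A → ∣ A ∣ ≟ _) {xs = subsets m} A∈I)

∈-tuples⁺ : {xs ys : List A} → All (_∈ xs) ys → ys ∈ tuples (length ys) xs
∈-tuples⁺ []       = here refl
∈-tuples⁺ (p ∷ ps) = ∈-cartesianProductWith⁺ _∷_ p (∈-tuples⁺ ps)

∈-tuples⁻ : ∀ r {xs ys : List A} → ys ∈ tuples r xs → length ys ≡ r × All (_∈ xs) ys
∈-tuples⁻ zero    (here refl) = refl , []
∈-tuples⁻ (suc r) {xs} p with ∈-cartesianProductWith⁻ _∷_ xs (tuples r xs) p
... | _ , _ , q , qs , refl with ∈-tuples⁻ r qs
...   | len , all = cong suc len , q ∷ all

∈-enumerations⁺ : (Λ : Family j m) → members Λ ∈ enumerations (size Λ) j m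
∈-enumerations⁺ (family _ u s) =
  ∈-filter⁺ (UniqueDec.unique? _≟ˢ_) (∈-tuples⁺ (All.map ∈-I⁺ s)) u

∈-enumerations⁻ : ∀ r {As} → As ∈ enumerations r j m →
                  Σ[ Λ ∈ Family j m ] members Λ ≡ As × size Λ ≡ r
∈-enumerations⁻ {j} {m} r p
  with ∈-filter⁻ (UniqueDec.unique? _≟ˢ_) {xs = tuples r (I j m)} p
... | q , u with ∈-tuples⁻ r q
...   | len , all = family _ u (All.map ∈-I⁻ all) , refl , len

K≤Kmax : (Λ : Family j m) → K Λ ≤ Kmax (size Λ) j m
K≤Kmax Λ = All.lookup (xs≤max 0 _) (∈-map⁺ overlaps (∈-enumerations⁺ Λ))

length-filter-map : ∀ b i j (As : List (Subset m)) →
  (∀ (A : Subset m) → (∣ b ∷ A ∣ ≡ᵇ j) ≡ (∣ A ∣ ≡ᵇ i)) →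
  length (filter (λ A → ∣ A ∣ ≟ j) (map (b ∷_) As)) ≡ length (filter (λ A → ∣ A ∣ ≟ i) As)
length-filter-map b i j []       eq = refl
length-filter-map b i j (A ∷ As) eq rewrite eq A with ∣ A ∣ ≡ᵇ i
... | true  = cong suc (length-filter-map b i j As eq)
... | false = length-filter-map b i j As eq

length-filter-inside-0 : (As : List (Subset m)) →
  length (filter (λ A → ∣ A ∣ ≟ 0) (map (inside ∷_) As)) ≡ 0
length-filter-inside-0 []       = refl
length-filter-inside-0 (A ∷ As) = length-filter-inside-0 As

length-I : ∀ j m → length (I j m) ≡ m C j
length-I zero    zero    = refl
length-I (suc j) zero    = refl
length-I zero    (suc m) = begin
  length (I 0 (suc m))
    ≡⟨ cong length (filter-++ (λ A → ∣ A ∣ ≟ 0) (map (inside ∷_) (subsets m)) _) ⟩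
  length (filter (λ A → ∣ A ∣ ≟ 0) (map (inside ∷_) (subsets m)) ++ _)
    ≡⟨ length-++ (filter (λ A → ∣ A ∣ ≟ 0) (map (inside ∷_) (subsets m))) ⟩
  _ ≡⟨ cong₂ _+_ (length-filter-inside-0 (subsets m))
                 (length-filter-map outside 0 0 (subsets m) (λ _ → refl)) ⟩
  length (I 0 m) ≡⟨ length-I 0 m ⟩
  m C 0          ∎
  where open ≡-Reasoning
length-I (suc j) (suc m) = begin
  length (I (suc j) (suc m))
    ≡⟨ cong length (filter-++ (λ A → ∣ A ∣ ≟ suc j) (map (inside ∷_) (subsets m)) _) ⟩
  length (filter (λ A → ∣ A ∣ ≟ suc j) (map (inside ∷_) (subsets m)) ++ _)
    ≡⟨ length-++ (filter (λ A → ∣ A ∣ ≟ suc j) (map (inside ∷_) (subsets m))) ⟩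
  _ ≡⟨ cong₂ _+_
         (length-filter-map inside j (suc j) (subsets m) (λ _ → refl))
         (length-filter-map outside (suc j) (suc j) (subsets m) (λ _ → refl)) ⟩
  length (I j m) + length (I (suc j) m) ≡⟨ cong₂ _+_ (length-I j m) (length-I (suc j) m) ⟩
  m C j + m C suc j                     ≡⟨ nCk+nC[k+1]≡[n+1]C[k+1] m j ⟩
  suc m C suc j                         ∎
  where open ≡-Reasoning

subsets-unique : ∀ m → Unique (subsets m)
subsets-unique zero    = [] ∷ []
subsets-unique (suc m) =
  Unique.++⁺ (Unique.map⁺ ∷-injectiveʳ (subsets-unique m))
             (Unique.map⁺ ∷-injectiveʳ (subsets-unique m))
             λ (p , q) → disjoint (∈-map⁻ _ p) (∈-map⁻ _ q)
  where
  disjoint : ∀ {A : Subset (suc m)} →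
             ∃[ B ] B ∈ subsets m × A ≡ inside ∷ B →
             ∃[ B ] B ∈ subsets m × A ≡ outside ∷ B → ⊥
  disjoint (_ , _ , refl) (_ , _ , ())

family-exists : ∀ r j m → r ≤ m C j → Σ[ Λ ∈ Family j m ] size Λ ≡ r
family-exists r j m r≤ =
  family (take r (I j m))
         (Unique.take⁺ r (Unique.filter⁺ (λ A → ∣ A ∣ ≟ j) (subsets-unique m)))
         (All.take⁺ r (All.all-filter (λ A → ∣ A ∣ ≟ j) (subsets m)))
  , trans (length-take r (I j m)) (m≤n⇒m⊓n≡m (subst (r ≤_) (sym (length-I j m)) r≤))

Kmax-attained : ∀ r j m → r ≤ m C j → Σ[ Λ ∈ Family j m ] size Λ ≡ r × K Λ ≡ Kmax r j m
Kmax-attained r j m r≤ with argmax-sel id 0 (map overlaps (enumerations r j m))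
... | inj₂ p with ∈-map⁻ overlaps p
...   | _ , q , eq with ∈-enumerations⁻ r q
...     | Λ , refl , len = Λ , len , sym eq
Kmax-attained r j m r≤ | inj₁ Kmax≡0 with family-exists r j m r≤
... | Λ , refl = Λ , refl , trans (n≤0⇒n≡0 (subst (K Λ ≤_) Kmax≡0 (K≤Kmax Λ))) (sym Kmax≡0)

{-# OPTIONS --safe #-}

-- By inclusion–exclusion, |A ∩ B| + m = |A| + |B| + |Aᶜ ∩ Bᶜ|.  Summing over
-- the pairs in Λ, K(Λ) and K(Λ⋆) differ by a constant that depends only on the
-- size of Λ, so complementation carries maximisers to maximisers.

module Submission where

open import Defs
open import Algebra.Properties.AbelianGroup using (∙-cancelʳ)
open import Data.Fin.Base using (Fin; zero; suc)
open import Data.Fin.Properties using (injective⇒≤)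
open import Data.Fin.Subset using (Subset; inside; outside; ∣_∣; _∩_; ∁)
open import Data.Integer.Base as ℤ using (+_)
import Data.Integer.Properties as ℤ
import Data.Integer.Tactic.RingSolver as ℤ
open import Data.List.Base using (List; []; _∷_; length; map; lookup)
open import Data.List.Membership.Propositional using (_∈_)
open import Data.List.Membership.Propositional.Properties using (∈-lookup)
open import Data.List.Membership.Setoid.Properties using (index-injective)
open import Data.List.Properties using (length-map)
open import Data.List.Relation.Unary.All as All using (All; []; _∷_)
open import Data.List.Relation.Unary.Unique.Propositional using (Unique; []; _∷_)
open import Data.Nat.Base using (ℕ; suc; _+_; _≤_; _∸_; _*_)
open import Data.Nat.Combinatorics using (_C_; nC1≡n; nCk≡nC[n∸k]; nCk+nC[k+1]≡[n+1]C[k+1])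
open import Data.Nat.ListAction using (sum)
open import Data.Nat.Properties
  using (+-suc; +-assoc; +-cancelˡ-≡; +-cancelʳ-≡; +-cancelʳ-≤; +-monoʳ-≤; ≤-antisym;
         m∸[m∸n]≡n; m+[n∸m]≡n; module ≤-Reasoning)
open import Data.Nat.Tactic.RingSolver using (solve-∀)
open import Data.Product.Base using (_×_; _,_)
open import Data.Vec.Base using ([]; _∷_)
open import Function.Bundles using (_⇔_; mk⇔)
open import Relation.Binary.PropositionalEquality
  using (_≡_; refl; sym; trans; cong; cong₂; subst; setoid; module ≡-Reasoning)
open import Relation.Nullary.Negation using (contradiction)

private
  variable
    m ℓ : ℕ
    X : Set

-- Each point of the ground set contributes equally to both sides: 2 if it lies in both sets,
-- otherwise 1. The additive form avoids truncated subtraction.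
∣p∩q∣+n≡∣p∣+∣q∣+∣∁p∩∁q∣ : (A B : Subset m) → ∣ A ∩ B ∣ + m ≡ ∣ A ∣ + ∣ B ∣ + ∣ ∁ A ∩ ∁ B ∣
∣p∩q∣+n≡∣p∣+∣q∣+∣∁p∩∁q∣ []            []            = refl
∣p∩q∣+n≡∣p∣+∣q∣+∣∁p∩∁q∣ {suc m} (inside  ∷ A) (inside  ∷ B) = begin
  suc (∣ A ∩ B ∣ + suc m)                      ≡⟨ cong suc (+-suc _ m) ⟩
  2 + (∣ A ∩ B ∣ + m)                          ≡⟨ cong (λ x → 2 + x) (∣p∩q∣+n≡∣p∣+∣q∣+∣∁p∩∁q∣ A B) ⟩
  2 + (∣ A ∣ + ∣ B ∣ + ∣ ∁ A ∩ ∁ B ∣)          ≡⟨ cong (λ x → suc (x + ∣ ∁ A ∩ ∁ B ∣)) (+-suc ∣ A ∣ _) ⟨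
  suc (∣ A ∣ + (suc ∣ B ∣) + ∣ ∁ A ∩ ∁ B ∣)    ∎
  where open ≡-Reasoning
∣p∩q∣+n≡∣p∣+∣q∣+∣∁p∩∁q∣ {suc m} (inside  ∷ A) (outside ∷ B) =
  trans (+-suc _ m) (cong suc (∣p∩q∣+n≡∣p∣+∣q∣+∣∁p∩∁q∣ A B))
∣p∩q∣+n≡∣p∣+∣q∣+∣∁p∩∁q∣ {suc m} (outside ∷ A) (inside  ∷ B) = begin
  ∣ A ∩ B ∣ + suc m                            ≡⟨ +-suc _ m ⟩
  suc (∣ A ∩ B ∣ + m)                          ≡⟨ cong suc (∣p∩q∣+n≡∣p∣+∣q∣+∣∁p∩∁q∣ A B) ⟩
  suc (∣ A ∣ + ∣ B ∣ + ∣ ∁ A ∩ ∁ B ∣)          ≡⟨ cong (_+ ∣ ∁ A ∩ ∁ B ∣) (+-suc ∣ A ∣ _) ⟨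
  ∣ A ∣ + (suc ∣ B ∣) + ∣ ∁ A ∩ ∁ B ∣          ∎
  where open ≡-Reasoning
∣p∩q∣+n≡∣p∣+∣q∣+∣∁p∩∁q∣ {suc m} (outside ∷ A) (outside ∷ B) = begin
  ∣ A ∩ B ∣ + suc m                            ≡⟨ +-suc _ m ⟩
  suc (∣ A ∩ B ∣ + m)                          ≡⟨ cong suc (∣p∩q∣+n≡∣p∣+∣q∣+∣∁p∩∁q∣ A B) ⟩
  suc (∣ A ∣ + ∣ B ∣ + ∣ ∁ A ∩ ∁ B ∣)          ≡⟨ +-suc _ _ ⟨
  ∣ A ∣ + ∣ B ∣ + (suc ∣ ∁ A ∩ ∁ B ∣)          ∎
  where open ≡-Reasoning

sum-∩-∁ : (A : Subset m) → ∣ A ∣ ≡ ℓ → {As : List (Subset m)} → All (λ B → ∣ B ∣ ≡ ℓ) As →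
          sum (map (λ B → ∣ A ∩ B ∣) As) + length As * m ≡
          length As * (2 * ℓ) + sum (map (λ B → ∣ ∁ A ∩ B ∣) (map ∁ As))
sum-∩-∁ A _ [] = refl
sum-∩-∁ {m} {ℓ} A refl {B ∷ As} (∣B∣≡ℓ ∷ s) = begin
  a + x + (m + n * m)                    ≡⟨ [m+n]+[o+p]≡[m+o]+[n+p] a x m (n * m) ⟩
  (a + m) + (x + n * m)
    ≡⟨ cong₂ _+_ (∣p∩q∣+n≡∣p∣+∣q∣+∣∁p∩∁q∣ A B) (sum-∩-∁ A refl s) ⟩
  (ℓ + ∣ B ∣ + a′) + (n * (2 * ℓ) + x′)
    -- Only `∣ B ∣` is left to replace: matching the size of `A` with `refl` has already made `ℓ`
    -- stand for `∣ A ∣`.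
    ≡⟨ cong (λ b → (ℓ + b + a′) + (n * (2 * ℓ) + x′)) ∣B∣≡ℓ ⟩
  (ℓ + ℓ + a′) + (n * (2 * ℓ) + x′)      ≡⟨ regroup ℓ a′ n x′ ⟩
  suc n * (2 * ℓ) + (a′ + x′)            ∎
  where
  open ≡-Reasoning
  n  = length As
  a  = ∣ A ∩ B ∣
  a′ = ∣ ∁ A ∩ ∁ B ∣
  x  = sum (map (λ B → ∣ A ∩ B ∣) As)
  x′ = sum (map (λ B → ∣ ∁ A ∩ B ∣) (map ∁ As))
  [m+n]+[o+p]≡[m+o]+[n+p] : ∀ m n o p → (m + n) + (o + p) ≡ (m + o) + (n + p)
  [m+n]+[o+p]≡[m+o]+[n+p] = solve-∀
  regroup : ∀ l a n x → (l + l + a) + (n * (2 * l) + x) ≡ suc n * (2 * l) + (a + x)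
  regroup = solve-∀

[1+n]C2≡n+nC2 : ∀ n → suc n C 2 ≡ n + n C 2
[1+n]C2≡n+nC2 n = trans (sym (nCk+nC[k+1]≡[n+1]C[k+1] n 1)) (cong (_+ n C 2) (nC1≡n n))

-- Induction on the list: `sum-∩-∁` handles the pairs containing the head, the induction hypothesis
-- the pairs inside the tail, and Pascal's rule `[1+n]C2≡n+nC2` counts the two kinds together.
overlaps-∁ : {As : List (Subset m)} → All (λ A → ∣ A ∣ ≡ ℓ) As →
             overlaps As + (length As C 2) * m ≡
             (length As C 2) * (2 * ℓ) + overlaps (map ∁ As)
overlaps-∁ [] = refl
overlaps-∁ {m} {ℓ} {A ∷ As} (∣A∣≡ℓ ∷ s) = begin
  x + y + (suc n C 2) * m                          ≡⟨ cong (λ c → x + y + c * m) ([1+n]C2≡n+nC2 n) ⟩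
  x + y + (n + n C 2) * m                          ≡⟨ split x y n (n C 2) m ⟩
  (x + n * m) + (y + (n C 2) * m)                  ≡⟨ cong₂ _+_ (sum-∩-∁ A ∣A∣≡ℓ s) (overlaps-∁ s) ⟩
  (n * (2 * ℓ) + x′) + ((n C 2) * (2 * ℓ) + y′)    ≡⟨ join n (n C 2) (2 * ℓ) x′ y′ ⟩
  (n + n C 2) * (2 * ℓ) + (x′ + y′)
    ≡⟨ cong (λ c → c * (2 * ℓ) + (x′ + y′)) ([1+n]C2≡n+nC2 n) ⟨
  (suc n C 2) * (2 * ℓ) + (x′ + y′)                ∎
  where
  open ≡-Reasoning
  n  = length As
  x  = sum (map (λ B → ∣ A ∩ B ∣) As)
  x′ = sum (map (λ B → ∣ ∁ A ∩ B ∣) (map ∁ As))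
  y  = overlaps As
  y′ = overlaps (map ∁ As)
  split : ∀ x y n c m → x + y + (n + c) * m ≡ (x + n * m) + (y + c * m)
  split = solve-∀
  join : ∀ n c l x y → (n * l + x) + (c * l + y) ≡ (n + c) * l + (x + y)
  join = solve-∀

K-⋆ : (Λ : Family ℓ m) → K Λ + (size Λ C 2) * m ≡ (size Λ C 2) * (2 * ℓ) + K (Λ ⋆)
K-⋆ Λ = overlaps-∁ (sizes Λ)

size-⋆ : (Λ : Family ℓ m) → size (Λ ⋆) ≡ size Λ
size-⋆ Λ = length-map ∁ (members Λ)

-- The complement of a maximiser for `ℓ` competes for the maximum at `m ∸ ℓ`, and `K-⋆` relates the
-- two values.
Kmax-≤ : ∀ r ℓ m → r ≤ m C ℓ →
         Kmax r ℓ m + (r C 2) * m ≤ (r C 2) * (2 * ℓ) + Kmax r (m ∸ ℓ) m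
Kmax-≤ r ℓ m r≤ with Kmax-attained r ℓ m r≤
... | Λ , refl , K≡ = begin
  Kmax r ℓ m + c * m              ≡⟨ cong (_+ c * m) K≡ ⟨
  K Λ + c * m                     ≡⟨ K-⋆ Λ ⟩
  c * (2 * ℓ) + K (Λ ⋆)           ≤⟨ +-monoʳ-≤ (c * (2 * ℓ)) (K≤Kmax (Λ ⋆)) ⟩
  c * (2 * ℓ) + Kmax (size (Λ ⋆)) (m ∸ ℓ) m
    ≡⟨ cong (λ s → c * (2 * ℓ) + Kmax s (m ∸ ℓ) m) (size-⋆ Λ) ⟩
  c * (2 * ℓ) + Kmax r (m ∸ ℓ) m  ∎
  where
  open ≤-Reasoning
  c = r C 2

-- The bound `Kmax-≤` for m ∸ ℓ is the reverse of the one for ℓ.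
Kmax-⋆ : ∀ r ℓ m → ℓ ≤ m → r ≤ m C ℓ →
         Kmax r ℓ m + (r C 2) * m ≡ (r C 2) * (2 * ℓ) + Kmax r (m ∸ ℓ) m
Kmax-⋆ r ℓ m ℓ≤m r≤ = ≤-antisym (Kmax-≤ r ℓ m r≤) (+-cancelʳ-≤ (c * m) _ _ (begin
  c * (2 * ℓ) + k′ + c * m                           ≡⟨ +-assoc (c * (2 * ℓ)) k′ (c * m) ⟩
  c * (2 * ℓ) + (k′ + c * m)
    ≤⟨ +-monoʳ-≤ (c * (2 * ℓ)) (Kmax-≤ r ℓ′ m (subst (r ≤_) (nCk≡nC[n∸k] ℓ≤m) r≤)) ⟩
  c * (2 * ℓ) + (c * (2 * ℓ′) + Kmax r (m ∸ ℓ′) m)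
    ≡⟨ cong (λ i → c * (2 * ℓ) + (c * (2 * ℓ′) + Kmax r i m)) (m∸[m∸n]≡n ℓ≤m) ⟩
  -- Since `ℓ + ℓ′` is `m`, the two constants add up to twice `c * m`: one copy belongs to the
  -- claim, the other is the summand added for cancellation.
  c * (2 * ℓ) + (c * (2 * ℓ′) + k)                   ≡⟨ gather c ℓ ℓ′ k ⟩
  k + c * (ℓ + ℓ′) + c * (ℓ + ℓ′)
    ≡⟨ cong (λ n → k + c * n + c * n) (m+[n∸m]≡n ℓ≤m) ⟩
  k + c * m + c * m                                  ∎))
  where
  open ≤-Reasoning
  c  = r C 2
  ℓ′ = m ∸ ℓ
  k  = Kmax r ℓ m
  k′ = Kmax r ℓ′ m
  gather : ∀ c l l′ k → c * (2 * l) + (c * (2 * l′) + k) ≡ k + c * (l + l′) + c * (l + l′)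
  gather = solve-∀

lookup-injective : {xs : List X} → Unique xs → ∀ {i j} → lookup xs i ≡ lookup xs j → i ≡ j
lookup-injective (_ ∷ _)   {zero}  {zero}  _  = refl
lookup-injective (x∉ ∷ _)  {zero}  {suc j} eq = contradiction eq (All.lookup x∉ (∈-lookup j))
lookup-injective (x∉ ∷ _)  {suc i} {zero}  eq = contradiction (sym eq) (All.lookup x∉ (∈-lookup i))
lookup-injective (_ ∷ u)   {suc i} {suc j} eq = cong suc (lookup-injective u eq)

-- Pigeonhole: sending a position in `Λ` to the position of its set in `I ℓ m` is injective because
-- the members are distinct. This makes `Kmax-⋆` applicable with `r = size Λ`.
size≤ : (Λ : Family ℓ m) → size Λ ≤ m C ℓ
size≤ {ℓ} {m} Λ = subst (size Λ ≤_) (length-I ℓ m) (injective⇒≤ λ {i} {j} eq →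
  lookup-injective (distinct Λ) (index-injective (setoid _) (∈I i) (∈I j) eq))
  where
  ∈I : (i : Fin (size Λ)) → lookup (members Λ) i ∈ I ℓ m
  ∈I i = ∈-I⁺ (All.lookup (sizes Λ) (∈-lookup i))

-- The coefficient `2 * ℓ - m` may be negative, so the subtraction-free identity over ℕ is
-- transferred to ℤ, where `c * m` can be moved across.
isolate-in-ℤ : ∀ c l {m x y} → x + c * m ≡ c * l + y → + x ≡ + c ℤ.* (+ l ℤ.- + m) ℤ.+ + y
isolate-in-ℤ c l {m} {x} {y} eq = ∙-cancelʳ ℤ.+-0-abelianGroup (+ c ℤ.* + m) _ _ (begin
  + x ℤ.+ + c ℤ.* + m              ≡⟨ cong (ℤ._+_ (+ x)) (ℤ.pos-* c m) ⟨
  + (x + c * m)                    ≡⟨ cong +_ eq ⟩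
  + (c * l + y)                    ≡⟨ cong (ℤ._+ + y) (ℤ.pos-* c l) ⟩
  + c ℤ.* + l ℤ.+ + y              ≡⟨ rearrange (+ c) (+ l) (+ m) (+ y) ⟩
  + c ℤ.* (+ l ℤ.- + m) ℤ.+ + y ℤ.+ + c ℤ.* + m  ∎)
  where
  open ≡-Reasoning
  rearrange : ∀ c l m y → c ℤ.* l ℤ.+ y ≡ c ℤ.* (l ℤ.- m) ℤ.+ y ℤ.+ c ℤ.* m
  rearrange = ℤ.solve-∀

proposition5 : ∀ (ℓ m : ℕ) → 1 ≤ ℓ → ℓ ≤ m →
    ((Λ : Family ℓ m) → Subclose Λ ⇔ Subclose (Λ ⋆))
    × (∀ (r : ℕ) → r ≤ m C ℓ →
    + Kmax r ℓ m ≡ + (r C 2) ℤ.* (+ (2 * ℓ) ℤ.- + m) ℤ.+ + Kmax r (m ∸ ℓ) m)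
proposition5 ℓ m _ ℓ≤m = subclose , λ r r≤ → isolate-in-ℤ (r C 2) (2 * ℓ) (Kmax-⋆ r ℓ m ℓ≤m r≤)
  where
  subclose : (Λ : Family ℓ m) → Subclose Λ ⇔ Subclose (Λ ⋆)
  -- The rewrite puts both maxima at `r = size Λ`. Then `K-⋆ Λ` and `Kmax≡` are the same relation
  -- with the same constants, one between the values of `Λ` and `Λ ⋆`, one between the maxima;
  -- equality with the maximum passes across by cancelling a constant.
  subclose Λ rewrite size-⋆ Λ = mk⇔
    (λ K≡ → +-cancelˡ-≡ (c * (2 * ℓ)) _ _ (trans (sym (K-⋆ Λ)) (trans (cong (_+ c * m) K≡) Kmax≡)))
    (λ K≡ → +-cancelʳ-≡ (c * m) _ _ (trans (K-⋆ Λ) (trans (cong (_+_ (c * (2 * ℓ))) K≡) (sym Kmax≡))))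
    where
    c     = size Λ C 2
    Kmax≡ = Kmax-⋆ (size Λ) ℓ m ℓ≤m (size≤ Λ)
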